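{- Let $G$ be a graph on $n$ vertices with chromatic number $\chi(G)$ and independence number $\alpha(G)$. Then: (i) $\varphi(G) \leq n-\chi(G)$; (ii) $\varphi(G) \leq \chi(G)\left(1-\dfrac{1}{\alpha(G)}\right)$; (iii) $\varphi(G) \leq n/3$.
   Context: All graphs are finite, simple and undirected, with at least one vertex. $\chi$ denotes the chromatic number. For a proper vertex coloring $c$ of $G$ and an induced subgraph $H$ of $G$, let $c(H)$ be the set of colors used by $c$ on the vertices of $H$. Define $\varphi_c(G)=\max_{H}\,(|c(H)|-\chi(H))$, the maximum over all induced subgraphs $H$ of $G$. The chromatic discrepancy is $\varphi(G)=\min_c \varphi_c(G)$, the minimum over all proper colorings $c$ of $G$ (with any number of colors). -}

module Defs where

open import Level using (0ℓ)
open import Data.Fin using (Fin; zero; suc; finToFun; funToFin)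
open import Data.Fin.Properties using (any?; all?; finToFun-funToFin)
import Data.Fin.Properties as Fin
open import Data.Fin.Subset using (Subset; inside; outside; _∈_; _⊆_; _∪_; ⁅_⁆; ∣_∣; Nonempty; ⊤; ⊥)
open import Data.Fin.Subset.Properties
  using (_∈?_; nonempty?; ∈⊤; ∉⊥; x∈p∪q⁺; x∈⁅x⁆; x∈⁅y⁆⇒x≡y; ∣⁅x⁆∣≡1; p⊆q⇒∣p∣≤∣q∣; ∣⊥∣≡0)
open import Data.Integer as ℤ using (ℤ; +_)
import Data.Integer.Properties as ℤ
open import Data.List using (List; []; _∷_; _++_; map; filter; upTo; allFin)
import Data.List.Extrema as Extrema
import Data.List.Membership.Propositional as List
open import Data.List.Membership.Propositional.Properties
  using (∈-++⁺ˡ; ∈-++⁺ʳ; ∈-map⁺; ∈-filter⁺; ∈-upTo⁺; ∈-allFin)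
open import Data.List.Relation.Unary.All using (lookup)
open import Data.List.Relation.Unary.All.Properties using (all-filter)
open import Data.List.Relation.Unary.Any using (here)
open import Data.Nat as ℕ using (ℕ; zero; suc; NonZero; z≤n; s≤s)
import Data.Nat.Properties as ℕ
open import Data.Product using (∃; ∃-syntax; _×_; _,_; proj₁; proj₂)
open import Data.Sum using (inj₁; inj₂)
open import Data.Vec using ([]; _∷_; tabulate; there)
open import Data.Vec.Properties using ([]=⇒lookup; lookup⇒[]=; lookup∘tabulate)
open import Function using (_∘_; id; flip; case_of_)
open import Relation.Binary using (Rel; Decidable; Symmetric; Irreflexive; TotalOrder)
open import Relation.Binary.PropositionalEquality
open import Relation.Nullary using (Dec; yes; no; ¬_; does; contradiction)
open import Relation.Nullary.Decidable using (map′; _×-dec_; _→-dec_; ¬?; dec-true)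
import Relation.Unary as U
open U using (Pred)

private
  variable
    n k : ℕ

record Graph (n : ℕ) : Set₁ where
  infix 4 _~_ _~?_
  field
    _~_      : Rel (Fin n) 0ℓ
    _~?_     : Decidable _~_
    ~-sym    : Symmetric _~_
    ~-irrefl : Irreflexive _≡_ _~_

IsLeast : ∀ {a r p} {A : Set a} → Rel A r → Pred A p → Pred A _
IsLeast _≤_ P x = P x × (∀ y → P y → x ≤ y)

IsGreatest : ∀ {a r p} {A : Set a} → Rel A r → Pred A p → Pred A _
IsGreatest _≤_ = IsLeast (flip _≤_)

-- An induced subgraph H = G[S] is represented by its vertex set S.  A coloring
-- of G[S] is a map on all of Fin n whose values outside S are disregarded;
-- since every such H is taken nonempty, any coloring of S alone extends to one.

ProperOn : Graph n → Subset n → (Fin n → Fin k) → Set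
ProperOn G S c = ∀ u v → u ∈ S → v ∈ S → u ~ v → c u ≢ c v
  where open Graph G

Proper : Graph n → (Fin n → Fin k) → Set
Proper G = ProperOn G ⊤

ColorableOn : Graph n → Subset n → ℕ → Set
ColorableOn {n} G S k = ∃[ c ] ProperOn {n} {k} G S c

Independent : Graph n → Subset n → Set
Independent G S = ∀ u v → u ∈ S → v ∈ S → ¬ u ~ v
  where open Graph G

colors : (Fin n → Fin k) → Subset n → Subset k
colors c S = tabulate λ i → does (any? λ v → v ∈? S ×-dec c v Fin.≟ i)

∈-colors⁺ : ∀ (c : Fin n → Fin k) {S v} → v ∈ S → c v ∈ colors c S
∈-colors⁺ c {S} {v} v∈S = lookup⇒[]= (c v) _
  (trans (lookup∘tabulate _ (c v)) (dec-true (any? _) (v , v∈S , refl)))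

∈-colors⁻ : ∀ (c : Fin n → Fin k) S {i} → i ∈ colors c S → ∃[ v ] v ∈ S × c v ≡ i
∈-colors⁻ c S {i} i∈ = go (any? _) (trans (sym (lookup∘tabulate _ i)) ([]=⇒lookup i∈))
  where
  go : ∀ {P : Set} (P? : Dec P) → does P? ≡ inside → P
  go (yes p) _ = p

properOn? : (G : Graph n) (S : Subset n) → U.Decidable (ProperOn {n} {k} G S)
properOn? G S c = all? λ u → all? λ v →
  u ∈? S →-dec (v ∈? S →-dec (u ~? v →-dec ¬? (c u Fin.≟ c v)))
  where open Graph G

independent? : (G : Graph n) → U.Decidable (Independent G)
independent? G S = all? λ u → all? λ v →
  u ∈? S →-dec (v ∈? S →-dec ¬? (u ~? v))
  where open Graph G

properOn-≗ : ∀ (G : Graph n) {S} {c d : Fin n → Fin k} → c ≗ d → ProperOn G S c → ProperOn G S d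
properOn-≗ G c≗d p u v u∈S v∈S u~v du≡dv =
  p u v u∈S v∈S u~v (trans (c≗d u) (trans du≡dv (sym (c≗d v))))

colorableOn? : (G : Graph n) (S : Subset n) → U.Decidable (ColorableOn G S)
colorableOn? G S k = map′
  (λ (i , p) → finToFun i , p)
  (λ (c , p) → funToFin c , properOn-≗ G (sym ∘ finToFun-funToFin c) p)
  (any? λ i → properOn? G S (finToFun i))

idProper : (G : Graph n) (S : Subset n) → ProperOn G S id
idProper G S u v _ _ u~v u≡v = Graph.~-irrefl G u≡v u~v

subsets : ∀ n → List (Subset n)
subsets zero    = [] ∷ []
subsets (suc n) = map (inside ∷_) (subsets n) ++ map (outside ∷_) (subsets n)

∈-subsets : (S : Subset n) → S List.∈ subsets n
∈-subsets []            = here refl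
∈-subsets (inside ∷ S)  = ∈-++⁺ˡ (∈-map⁺ _ (∈-subsets S))
∈-subsets (outside ∷ S) = ∈-++⁺ʳ _ (∈-map⁺ _ (∈-subsets S))

module _ (O : TotalOrder 0ℓ 0ℓ 0ℓ) where
  open TotalOrder O using (Carrier; _≤_)
  open Extrema O

  module _ {a p} {A : Set a} (f : A → Carrier) {P : Pred A p} (P? : U.Decidable P)
           (x₀ : A) (px₀ : P x₀) (xs : List A) where

    minimize : ∃[ x ] P x × f x ≤ f x₀ × (∀ y → y List.∈ xs → P y → f x ≤ f y)
    minimize = argmin f x₀ (filter P? xs) , argmin-all f px₀ (all-filter P? xs)
      , f[argmin]≤f[⊤] {f = f} x₀ (filter P? xs)
      , λ y y∈ py → lookup (f[argmin]≤f[xs] {f = f} x₀ (filter P? xs)) (∈-filter⁺ P? y∈ py)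

    maximize : ∃[ x ] P x × (∀ y → y List.∈ xs → P y → f y ≤ f x)
    maximize = argmax f x₀ (filter P? xs) , argmax-all f px₀ (all-filter P? xs)
      , λ y y∈ py → lookup (f[xs]≤f[argmax] {f = f} x₀ (filter P? xs)) (∈-filter⁺ P? y∈ py)

∣∪∣≤ : (p q : Subset n) → ∣ p ∪ q ∣ ℕ.≤ ∣ p ∣ ℕ.+ ∣ q ∣
∣∪∣≤ []            []            = z≤n
∣∪∣≤ (inside ∷ p)  (inside ∷ q)  = s≤s (ℕ.≤-trans (∣∪∣≤ p q) (ℕ.+-monoʳ-≤ ∣ p ∣ (ℕ.n≤1+n _)))
∣∪∣≤ (inside ∷ p)  (outside ∷ q) = s≤s (∣∪∣≤ p q)
∣∪∣≤ (outside ∷ p) (inside ∷ q)  =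
  ℕ.≤-trans (s≤s (∣∪∣≤ p q)) (ℕ.≤-reflexive (sym (ℕ.+-suc ∣ p ∣ ∣ q ∣)))
∣∪∣≤ (outside ∷ p) (outside ∷ q) = ∣∪∣≤ p q

∣colors∣≤ : (g : Fin k → Fin n) (p : Subset k) → ∣ colors g p ∣ ℕ.≤ ∣ p ∣
∣colors∣≤ {n = n} g [] = ℕ.≤-trans (p⊆q⇒∣p∣≤∣q∣ {q = ⊥} sub) (ℕ.≤-reflexive (∣⊥∣≡0 n))
  where
  sub : colors g [] ⊆ ⊥
  sub i∈ with ∈-colors⁻ g [] i∈
  ... | () , _
∣colors∣≤ g (outside ∷ p) = ℕ.≤-trans (p⊆q⇒∣p∣≤∣q∣ sub) (∣colors∣≤ (g ∘ suc) p)
  where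
  sub : colors g (outside ∷ p) ⊆ colors (g ∘ suc) p
  sub i∈ with ∈-colors⁻ g (outside ∷ p) i∈
  ... | suc v , there v∈p , refl = ∈-colors⁺ (g ∘ suc) v∈p
∣colors∣≤ g (inside ∷ p) = ℕ.≤-trans (p⊆q⇒∣p∣≤∣q∣ sub)
  (ℕ.≤-trans (∣∪∣≤ ⁅ g zero ⁆ _)
    (ℕ.+-mono-≤ (ℕ.≤-reflexive (∣⁅x⁆∣≡1 (g zero))) (∣colors∣≤ (g ∘ suc) p)))
  where
  sub : colors g (inside ∷ p) ⊆ ⁅ g zero ⁆ ∪ colors (g ∘ suc) p
  sub i∈ with ∈-colors⁻ g (inside ∷ p) i∈
  ... | zero  , _ , refl = x∈p∪q⁺ (inj₁ (x∈⁅x⁆ _))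
  ... | suc v , there v∈p , refl = x∈p∪q⁺ (inj₂ (∈-colors⁺ (g ∘ suc) v∈p))

∣colors-∘∣≤ : (g : Fin k → Fin n) (c : Fin n → Fin k) (S : Subset n) →
              ∣ colors (g ∘ c) S ∣ ℕ.≤ ∣ colors c S ∣
∣colors-∘∣≤ g c S = ℕ.≤-trans (p⊆q⇒∣p∣≤∣q∣ sub) (∣colors∣≤ g (colors c S))
  where
  sub : colors (g ∘ c) S ⊆ colors g (colors c S)
  sub i∈ with ∈-colors⁻ (g ∘ c) S i∈
  ... | v , v∈S , refl = ∈-colors⁺ g (∈-colors⁺ c v∈S)

recolor : .{{NonZero n}} → (c : Fin n → Fin k) →
          ∃ λ (g : Fin k → Fin n) → ∀ v → c (g (c v)) ≡ c v
recolor {n = suc n} {k} c = g , λ v → section v (any? λ u → c u Fin.≟ c v)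
  where
  pick : ∀ {i} → Dec (∃[ u ] c u ≡ i) → Fin (suc n)
  pick (yes (u , _)) = u
  pick (no _)        = zero

  g : Fin k → Fin (suc n)
  g i = pick (any? λ u → c u Fin.≟ i)

  section : ∀ v (d : Dec (∃[ u ] c u ≡ c v)) → c (pick d) ≡ c v
  section v (yes (_ , eq)) = eq
  section v (no ∄)         = contradiction (v , refl) ∄

⊤-nonempty : .{{NonZero n}} → Nonempty {n} ⊤
⊤-nonempty {suc n} = zero , ∈⊤

abstract
  χOn-exists : (G : Graph n) (S : Subset n) → ∃ (IsLeast ℕ._≤_ (ColorableOn G S))
  χOn-exists {n} G S =
    let m , pm , m≤n , least = minimize ℕ.≤-totalOrder id (colorableOn? G S) n (id , idProper G S) (upTo n)
    in m , pm , λ j pj → case j ℕ.<? n of λ where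
         (yes j<n) → least j (∈-upTo⁺ j<n) pj
         (no j≮n)  → ℕ.≤-trans m≤n (ℕ.≮⇒≥ j≮n)

χOn : Graph n → Subset n → ℕ
χOn G S = proj₁ (χOn-exists G S)

χ : Graph n → ℕ
χ G = χOn G ⊤

χOn-isLeast : (G : Graph n) (S : Subset n) → IsLeast ℕ._≤_ (ColorableOn G S) (χOn G S)
χOn-isLeast G S = proj₂ (χOn-exists G S)

IndependentSetSize : Graph n → Pred ℕ 0ℓ
IndependentSetSize G m = ∃[ S ] Independent G S × m ≡ ∣ S ∣

abstract
  α-exists : (G : Graph n) → ∃ (IsGreatest ℕ._≤_ (IndependentSetSize G))
  α-exists {n} G =
    let S , iS , greatest = maximize ℕ.≤-totalOrder ∣_∣ (independent? G) ⊥
                              (λ _ _ u∈⊥ → contradiction u∈⊥ ∉⊥) (subsets n)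
    in ∣ S ∣ , (S , iS , refl) , λ { _ (T , iT , refl) → greatest T (∈-subsets T) iT }

α : Graph n → ℕ
α G = proj₁ (α-exists G)

α-isGreatest : (G : Graph n) → IsGreatest ℕ._≤_ (IndependentSetSize G) (α G)
α-isGreatest G = proj₂ (α-exists G)

α-nonZero : .{{NonZero n}} → (G : Graph n) → NonZero (α G)
α-nonZero {suc n} G = ℕ.>-nonZero (subst (ℕ._≤ α G) (∣⁅x⁆∣≡1 {suc n} zero)
  (proj₂ (α-isGreatest G) _ (⁅ zero ⁆ , independent , refl)))
  where
  independent : Independent G ⁅ zero ⁆
  independent u v u∈ v∈ =
    Graph.~-irrefl G (trans (x∈⁅y⁆⇒x≡y zero u∈) (sym (x∈⁅y⁆⇒x≡y zero v∈)))

excess : Graph n → (Fin n → Fin k) → Subset n → ℤ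
excess G c S = + ∣ colors c S ∣ ℤ.- + χOn G S

Excess : Graph n → (Fin n → Fin k) → Pred ℤ 0ℓ
Excess G c z = ∃[ S ] Nonempty S × z ≡ excess G c S

abstract
  φOf-exists : .{{_ : NonZero n}} (G : Graph n) (c : Fin n → Fin k) → ∃ (IsGreatest ℤ._≤_ (Excess G c))
  φOf-exists {n} G c =
    let S , neS , greatest = maximize ℤ.≤-totalOrder (excess G c) nonempty? ⊤ ⊤-nonempty (subsets n)
    in excess G c S , (S , neS , refl) , λ { _ (T , neT , refl) → greatest T (∈-subsets T) neT }

φOf : .{{_ : NonZero n}} → Graph n → (Fin n → Fin k) → ℤ
φOf G c = proj₁ (φOf-exists G c)

φOf-isGreatest : .{{_ : NonZero n}} (G : Graph n) (c : Fin n → Fin k) →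
                 IsGreatest ℤ._≤_ (Excess G c) (φOf G c)
φOf-isGreatest G c = proj₂ (φOf-exists G c)

ColoringDiscrepancy : .{{_ : NonZero n}} → Graph n → Pred ℤ 0ℓ
ColoringDiscrepancy {n} G z = ∃[ k ] ∃[ c ] Proper {n} {k} G c × z ≡ φOf G c

φOf-mono : .{{_ : NonZero n}} (G : Graph n) {j : ℕ} (d : Fin n → Fin j) (c : Fin n → Fin k) →
           (∀ S → ∣ colors d S ∣ ℕ.≤ ∣ colors c S ∣) → φOf G d ℤ.≤ φOf G c
φOf-mono G d c d≤c with φOf-isGreatest G d
... | (S , neS , eq) , _ = subst (ℤ._≤ φOf G c) (sym eq)
  (ℤ.≤-trans (ℤ.+-monoˡ-≤ (ℤ.- + χOn G S) (ℤ.+≤+ (d≤c S)))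
             (proj₂ (φOf-isGreatest G c) _ (S , neS , refl)))

∣colors∣-≗ : ∀ {c d : Fin n → Fin k} → c ≗ d → ∀ S → ∣ colors c S ∣ ℕ.≤ ∣ colors d S ∣
∣colors∣-≗ {c = c} {d} c≗d S = p⊆q⇒∣p∣≤∣q∣ sub
  where
  sub : colors c S ⊆ colors d S
  sub i∈ with ∈-colors⁻ c S i∈
  ... | v , v∈S , refl = subst (_∈ colors d S) (sym (c≗d v)) (∈-colors⁺ d v∈S)

-- The minimum over proper colorings with any number k of colors is attained
-- among those with colors in Fin n: recolor each class by one of its vertices.
φOf-recolor : .{{_ : NonZero n}} (G : Graph n) (c : Fin n → Fin k) → Proper G c →
              ∃[ i ] Proper {n} {n} G (finToFun i) × φOf {k = n} G (finToFun i) ℤ.≤ φOf G c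
φOf-recolor {n} G c pc with recolor c
... | g , section =
      funToFin d
    , properOn-≗ G (sym ∘ e≗d) pd
    , φOf-mono G (finToFun (funToFin d)) c λ S → ℕ.≤-trans (∣colors∣-≗ e≗d S) (∣colors-∘∣≤ g c S)
  where
  d : Fin n → Fin n
  d = g ∘ c

  e≗d : finToFun (funToFin d) ≗ d
  e≗d = finToFun-funToFin d

  pd : Proper G d
  pd u v u∈ v∈ u~v du≡dv = pc u v u∈ v∈ u~v
    (trans (sym (section u)) (trans (cong c du≡dv) (section v)))

abstract
  φ-exists : .{{_ : NonZero n}} (G : Graph n) → ∃ (IsLeast ℤ._≤_ (ColoringDiscrepancy G))
  φ-exists {n} G =
    let c₀ , pc₀ , _ , least = minimize ℤ.≤-totalOrder (φOf {k = n} G) (properOn? G ⊤)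
                                 id (idProper G ⊤) (map finToFun (allFin (n ℕ.^ n)))
    in φOf G c₀ , (n , c₀ , pc₀ , refl) , λ { _ (k , c , pc , refl) →
         let i , pi , le = φOf-recolor G c pc
         in ℤ.≤-trans (least (finToFun i) (∈-map⁺ finToFun (∈-allFin i)) pi) le }

φ : .{{_ : NonZero n}} → Graph n → ℤ
φ G = proj₁ (φ-exists G)

φ-isLeast : .{{_ : NonZero n}} (G : Graph n) → IsLeast ℤ._≤_ (ColoringDiscrepancy G) (φ G)
φ-isLeast G = proj₂ (φ-exists G)

{-# OPTIONS --safe #-}

-- Every induced subgraph H satisfies |c(H)| ≤ |H|, |c(H)| ≤ χ(G) for an optimal
-- coloring c, χ(G) ≤ χ(H) + n − |H| and |H| ≤ α(G) χ(H); these give (i) and (ii).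
-- For (iii), color greedily: use classes that are independent sets of size at
-- least 3 while they exist, then classes of size 2, then single vertices.  On the
-- vertices left after the first phase α ≤ 2, hence |H| ≤ 2 χ(H) there, while the
-- last phase colors a clique.  Weighing these bounds gives 3|c(H)| ≤ n + 3 χ(H).
-- The same argument with j phases gives j|c(H)| ≤ n + j(j−1)/2 χ(H).

module Submission where

open import Defs
open import Data.Fin using (Fin; _↑ˡ_; _↑ʳ_; splitAt)
import Data.Fin.Properties as Fin
open import Data.Fin.Subset
  using (Subset; inside; outside; _∈_; _∉_; _⊆_; _∩_; _∪_; _─_; ∁; ⁅_⁆; ∣_∣; Nonempty; ⊤)
open import Data.Fin.Subset.Properties
open import Data.Integer as ℤ using (+_)
import Data.Integer.Properties as ℤ
open import Data.List using (List; []; _∷_; length; allFin)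
import Data.List.Membership.Propositional as List
open import Data.List.Membership.Propositional.Properties using (∈-allFin)
open import Data.List.Properties using (length-tabulate)
open import Data.List.Relation.Unary.Any using (here; there)
open import Data.Nat using (ℕ; zero; suc; NonZero; _+_; _*_; _∸_; _≤_; _<_; _<?_; z≤n; s≤s)
open import Data.Nat.Induction using (<-wellFounded)
open import Data.Nat.Properties hiding (_≟_)
open import Data.Product using (∃-syntax; _×_; _,_; proj₂)
open import Data.Rational as ℚ using (1ℚ; _/_)
import Data.Rational.Properties as ℚ
open import Data.Rational.Unnormalised as ℚᵘ using (mkℚᵘ)
import Data.Rational.Unnormalised.Properties as ℚᵘ
open import Data.Sum using (inj₁; inj₂)
open import Data.Vec using ([]; _∷_; here; there; tabulate)
open import Data.Vec.Properties using ([]=⇒lookup; lookup⇒[]=; lookup∘tabulate)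
open import Function using (_∘_; id)
open import Induction.WellFounded using (Acc; acc)
open import Relation.Binary.PropositionalEquality
open import Relation.Nullary using (Dec; yes; no; ¬_; does; contradiction)
open import Relation.Nullary.Decidable using (_×-dec_; dec-true)
open import Algebra.Properties.CommutativeSemigroup +-commutativeSemigroup using (x∙yz≈y∙xz)

private
  variable
    n k : ℕ

-- Finite subsets: differences and enumeration.

∣p∩q∣+∣p─q∣≡∣p∣ : (p q : Subset n) → ∣ p ∩ q ∣ + ∣ p ─ q ∣ ≡ ∣ p ∣
∣p∩q∣+∣p─q∣≡∣p∣ []            []            = refl
∣p∩q∣+∣p─q∣≡∣p∣ (inside ∷ p)  (inside ∷ q)  = cong suc (∣p∩q∣+∣p─q∣≡∣p∣ p q)
∣p∩q∣+∣p─q∣≡∣p∣ (inside ∷ p)  (outside ∷ q) =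
  trans (+-suc ∣ p ∩ q ∣ _) (cong suc (∣p∩q∣+∣p─q∣≡∣p∣ p q))
∣p∩q∣+∣p─q∣≡∣p∣ (outside ∷ p) (inside ∷ q)  = ∣p∩q∣+∣p─q∣≡∣p∣ p q
∣p∩q∣+∣p─q∣≡∣p∣ (outside ∷ p) (outside ∷ q) = ∣p∩q∣+∣p─q∣≡∣p∣ p q

q⊆p⇒∣q∣+∣p─q∣≤∣p∣ : (p q : Subset n) → q ⊆ p → ∣ q ∣ + ∣ p ─ q ∣ ≤ ∣ p ∣
q⊆p⇒∣q∣+∣p─q∣≤∣p∣ p q q⊆p = ≤-trans
  (+-monoˡ-≤ _ (p⊆q⇒∣p∣≤∣q∣ λ x∈q → x∈p∩q⁺ (q⊆p x∈q , x∈q)))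
  (≤-reflexive (∣p∩q∣+∣p─q∣≡∣p∣ p q))

x∈p─q⇒x∉q : ∀ (p q : Subset n) {x} → x ∈ p ─ q → x ∉ q
x∈p─q⇒x∉q (_ ∷ p) (inside ∷ q)  (there x∈) (there x∈q) = x∈p─q⇒x∉q p q x∈ x∈q
x∈p─q⇒x∉q (_ ∷ p) (outside ∷ q) (there x∈) (there x∈q) = x∈p─q⇒x∉q p q x∈ x∈q

─-monoˡ-⊆ : ∀ {p q : Subset n} r → p ⊆ q → p ─ r ⊆ q ─ r
─-monoˡ-⊆ {p = p} r p⊆q x∈ = x∈p∧x∉q⇒x∈p─q (p⊆q (p─q⊆p p r x∈)) (x∈p─q⇒x∉q p r x∈)

0<∣p∣⇒nonempty : (p : Subset n) → 0 < ∣ p ∣ → Nonempty p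
0<∣p∣⇒nonempty {n} p 0<∣p∣ with nonempty? p
... | yes ne = ne
... | no ¬ne = contradiction (subst (0 <_) (trans (cong ∣_∣ (Empty-unique ¬ne)) (∣⊥∣≡0 n)) 0<∣p∣) λ ()

-- Position among the members of `p`; it supplies pairwise distinct fresh colors for the vertices
-- outside a colored set.
rank : (p : Subset n) {x : Fin n} → x ∈ p → Fin ∣ p ∣
rank (_ ∷ p)       here       = Fin.zero
rank (inside ∷ p)  (there x∈) = Fin.suc (rank p x∈)
rank (outside ∷ p) (there x∈) = rank p x∈

rank-injective : ∀ (p : Subset n) {x y} (x∈ : x ∈ p) (y∈ : y ∈ p) → rank p x∈ ≡ rank p y∈ → x ≡ y
rank-injective (_ ∷ p)       here       here       eq = refl
rank-injective (_ ∷ p)       here       (there y∈) ()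
rank-injective (_ ∷ p)       (there x∈) here       ()
rank-injective (inside ∷ p)  (there x∈) (there y∈) eq =
  cong Fin.suc (rank-injective p x∈ y∈ (Fin.suc-injective eq))
rank-injective (outside ∷ p) (there x∈) (there y∈) eq =
  cong Fin.suc (rank-injective p x∈ y∈ eq)

-- Color classes.

fibre : (Fin n → Fin k) → Fin k → Subset n
fibre c i = tabulate λ v → does (c v Fin.≟ i)

∈-fibre⁺ : ∀ (c : Fin n → Fin k) {v i} → c v ≡ i → v ∈ fibre c i
∈-fibre⁺ c {v} eq = lookup⇒[]= v _ (trans (lookup∘tabulate _ v) (dec-true (c v Fin.≟ _) eq))

∈-fibre⁻ : ∀ (c : Fin n → Fin k) {v i} → v ∈ fibre c i → c v ≡ i
∈-fibre⁻ c {v} {i} v∈ = go (c v Fin.≟ i) (trans (sym (lookup∘tabulate _ v)) ([]=⇒lookup v∈))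
  where
  go : ∀ {P : Set} (P? : Dec P) → does P? ≡ inside → P
  go (yes p) _ = p

-- Induction on the list of available colors: the class of the first color is split off, and what
-- remains of `S` avoids that color.
∣S∣≤colors*fibre : ∀ (c : Fin n → Fin k) {a} (is : List (Fin k)) S → (∀ {v} → v ∈ S → c v List.∈ is) →
                   (∀ i → ∣ S ∩ fibre c i ∣ ≤ a) → ∣ S ∣ ≤ length is * a
∣S∣≤colors*fibre c [] S c∈ _ = ≮⇒≥ λ 0<∣S∣ →
  let v , v∈S = 0<∣p∣⇒nonempty S 0<∣S∣ in contradiction (c∈ v∈S) λ ()
∣S∣≤colors*fibre c (i ∷ is) S c∈ bound = ≤-trans
  (≤-reflexive (sym (∣p∩q∣+∣p─q∣≡∣p∣ S (fibre c i))))
  (+-mono-≤ (bound i) (∣S∣≤colors*fibre c is S′ c∈′ λ j → ≤-trans (p⊆q⇒∣p∣≤∣q∣ (sub j)) (bound j)))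
  where
  S′ = S ─ fibre c i

  c∈′ : ∀ {v} → v ∈ S′ → c v List.∈ is
  c∈′ v∈ with c∈ (p─q⊆p S (fibre c i) v∈)
  ... | here cv≡i = contradiction (∈-fibre⁺ c cv≡i) (x∈p─q⇒x∉q S (fibre c i) v∈)
  ... | there cv∈ = cv∈

  sub : ∀ j → S′ ∩ fibre c j ⊆ S ∩ fibre c j
  sub j x∈ = let x∈S′ , x∈f = x∈p∩q⁻ S′ (fibre c j) x∈
             in x∈p∩q⁺ (p─q⊆p S (fibre c i) x∈S′ , x∈f)

-- Bounds on the chromatic number of an induced subgraph.

module _ (G : Graph n) where
  open Graph G

  χOn-mono : ∀ {S T} → S ⊆ T → χOn G S ≤ χOn G T
  χOn-mono {S} {T} S⊆T = let (c , pc) , _ = χOn-isLeast G T in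
    proj₂ (χOn-isLeast G S) _ (c , λ u v u∈ v∈ → pc u v (S⊆T u∈) (S⊆T v∈))

  -- An optimal coloring splits `S` into independent classes. Only independent sets inside `S` are
  -- bounded, since the greedy argument controls no others.
  ∣S∣≤χOn*a : ∀ S {a} → (∀ I → I ⊆ S → Independent G I → ∣ I ∣ ≤ a) → ∣ S ∣ ≤ χOn G S * a
  ∣S∣≤χOn*a S {a} bound = let (c , pc) , _ = χOn-isLeast G S in
    ≤-trans
      (∣S∣≤colors*fibre c (allFin _) S (λ _ → ∈-allFin _) λ i →
        bound _ (p∩q⊆p S (fibre c i)) λ u v u∈ v∈ u~v →
          let u∈S , u∈f = x∈p∩q⁻ S (fibre c i) u∈
              v∈S , v∈f = x∈p∩q⁻ S (fibre c i) v∈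
          in pc u v u∈S v∈S u~v (trans (∈-fibre⁻ c u∈f) (sym (∈-fibre⁻ c v∈f))))
      (≤-reflexive (cong (_* a) (length-tabulate {n = χOn G S} id)))

  -- Extend an optimal coloring of `S` by giving each outside vertex a color of its own.
  χ≤χOn+∣∁∣ : ∀ S → χ G ≤ χOn G S + ∣ ∁ S ∣
  χ≤χOn+∣∁∣ S = let (c , pc) , _ = χOn-isLeast G S in
    proj₂ (χOn-isLeast G ⊤) _ (extend c , extend-proper c pc)
    where
    module _ (c : Fin n → Fin (χOn G S)) where
      extendAt : ∀ v → Dec (v ∈ S) → Fin (χOn G S + ∣ ∁ S ∣)
      extendAt v (yes _)  = c v ↑ˡ ∣ ∁ S ∣
      extendAt v (no v∉S) = χOn G S ↑ʳ rank (∁ S) (x∉p⇒x∈∁p v∉S)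

      extend : Fin n → Fin (χOn G S + ∣ ∁ S ∣)
      extend v = extendAt v (v ∈? S)

      extend-proper : ProperOn G S c → Proper G extend
      extend-proper pc u v _ _ u~v eq = go (u ∈? S) (v ∈? S) eq
        where
        ↑ˡ≢↑ʳ : ∀ {i j} → i ↑ˡ ∣ ∁ S ∣ ≢ χOn G S ↑ʳ j
        ↑ˡ≢↑ʳ {i} {j} eq = contradiction
          (trans (sym (Fin.splitAt-↑ˡ _ i _)) (trans (cong (splitAt _) eq) (Fin.splitAt-↑ʳ _ _ j))) λ ()

        go : ∀ u∈? v∈? → extendAt u u∈? ≢ extendAt v v∈?
        go (yes u∈S) (yes v∈S) eq = pc u v u∈S v∈S u~v (Fin.↑ˡ-injective _ _ _ eq)
        go (yes _)   (no _)    eq = ↑ˡ≢↑ʳ eq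
        go (no _)    (yes _)   eq = ↑ˡ≢↑ʳ (sym eq)
        go (no u∉S)  (no v∉S)  eq = ~-irrefl
          (rank-injective (∁ S) (x∉p⇒x∈∁p u∉S) (x∉p⇒x∈∁p v∉S) (Fin.↑ʳ-injective (χOn G S) _ _ eq)) u~v

-- Adding an independent class `I`, colored by its member `x`.

module _ (G : Graph n) {c : Fin n → Fin n} {U I : Subset n} {x : Fin n} (x∈U : x ∈ U)
         (x∈I : x ∈ I) (independent : Independent G I) (proper : ProperOn G (U ─ I) c)
         (closed : ∀ {v} → v ∈ U ─ I → c v ∈ U ─ I) where
  open Graph G

  addClassAt : ∀ v → Dec (v ∈ I) → Fin n
  addClassAt v (yes _) = x
  addClassAt v (no _)  = c v

  addClass : Fin n → Fin n
  addClass v = addClassAt v (v ∈? I)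

  addClass-closed : ∀ {v} → v ∈ U → addClass v ∈ U
  addClass-closed {v} v∈U with v ∈? I
  ... | yes _  = x∈U
  ... | no v∉I = p─q⊆p U I (closed (x∈p∧x∉q⇒x∈p─q v∈U v∉I))

  -- By `closed`, the colors on `U ─ I` are vertices of `U ─ I`, whereas `x` lies in `I`.
  x≢c : ∀ {v} → v ∈ U ─ I → x ≢ c v
  x≢c v∈ refl = x∈p─q⇒x∉q U I (closed v∈) x∈I

  addClass-proper : ProperOn G U addClass
  addClass-proper u v u∈U v∈U u~v eq with u ∈? I | v ∈? I
  ... | yes u∈I | yes v∈I = independent u v u∈I v∈I u~v
  ... | yes _   | no v∉I  = x≢c (x∈p∧x∉q⇒x∈p─q v∈U v∉I) eq
  ... | no u∉I  | yes _   = x≢c (x∈p∧x∉q⇒x∈p─q u∈U u∉I) (sym eq)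
  ... | no u∉I  | no v∉I  =
    proper u v (x∈p∧x∉q⇒x∈p─q u∈U u∉I) (x∈p∧x∉q⇒x∈p─q v∈U v∉I) u~v eq

  ∣colors-addClass∣≤ : ∀ H → ∣ colors addClass H ∣ ≤ 1 + ∣ colors c (H ─ I) ∣
  ∣colors-addClass∣≤ H = ≤-trans (p⊆q⇒∣p∣≤∣q∣ sub)
    (≤-trans (∣∪∣≤ ⁅ x ⁆ _) (+-monoˡ-≤ _ (≤-reflexive (∣⁅x⁆∣≡1 x))))
    where
    at : ∀ {v} → v ∈ H → (d : Dec (v ∈ I)) → addClassAt v d ∈ ⁅ x ⁆ ∪ colors c (H ─ I)
    at v∈H (yes _)  = x∈p∪q⁺ (inj₁ (x∈⁅x⁆ x))
    at v∈H (no v∉I) = x∈p∪q⁺ (inj₂ (∈-colors⁺ c (x∈p∧x∉q⇒x∈p─q v∈H v∉I)))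

    sub : colors addClass H ⊆ ⁅ x ⁆ ∪ colors c (H ─ I)
    sub i∈ with ∈-colors⁻ addClass H i∈
    ... | v , v∈H , refl = at v∈H (v ∈? I)

-- The greedy coloring.

-- This is j(j-1)/2. The summand i is the multiple of χ(H) charged once no independent set has more
-- than i vertices.
triangle : ℕ → ℕ
triangle zero    = 0
triangle (suc j) = j + triangle j

-- The colors of U are among its own vertices, so that a class removed from a
-- larger set can be colored by one of its members without a clash.
GreedyColoring : Graph n → ℕ → Subset n → Set
GreedyColoring {n} G j U = ∃[ c ]
    ProperOn {n} {n} G U c
  × (∀ {v} → v ∈ U → c v ∈ U)
  × (∀ H → H ⊆ U → j * ∣ colors c H ∣ ≤ ∣ U ∣ + triangle j * χOn G H)

-- Recursion on the size of `U`. A class with more than `j` vertices pays for its color: the left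
-- side grows by at most `suc j`, the right by at least that. When no such class is left, every `H`
-- has at most j χ(H) vertices, and adding this to the bound for `j` gives the claim.
greedy-step : (G : Graph n) (j : ℕ) → (∀ U → GreedyColoring G j U) →
              ∀ U → Acc _<_ ∣ U ∣ → GreedyColoring G (suc j) U
greedy-step G j greedy-j U (acc rs)
  with anySubset? (λ I → I ⊆? U ×-dec independent? G I ×-dec j <? ∣ I ∣)
... | no ∄I =
  let c , proper , closed , bound = greedy-j U
  in c , proper , closed , λ H H⊆U →
    let m = ∣ colors c H ∣
        h = χOn G H
        m≤jh = ≤-trans (∣colors∣≤ c H) (subst (∣ H ∣ ≤_) (*-comm h j)
                 (∣S∣≤χOn*a G H λ I I⊆H iI → ≮⇒≥ λ j<∣I∣ → ∄I (I , H⊆U ∘ I⊆H , iI , j<∣I∣)))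
    in begin
      m + j * m                           ≤⟨ +-mono-≤ m≤jh (bound H H⊆U) ⟩
      j * h + (∣ U ∣ + triangle j * h)    ≡⟨ x∙yz≈y∙xz (j * h) ∣ U ∣ _ ⟩
      ∣ U ∣ + (j * h + triangle j * h)    ≡⟨ cong (_+_ ∣ U ∣) (*-distribʳ-+ h j (triangle j)) ⟨
      ∣ U ∣ + (j + triangle j) * h        ∎
  where open ≤-Reasoning
... | yes (I , I⊆U , iI , j<∣I∣) =
  let ∣I∣+∣U─I∣≤∣U∣ = q⊆p⇒∣q∣+∣p─q∣≤∣p∣ U I I⊆U
      x , x∈I = 0<∣p∣⇒nonempty I (≤-trans (s≤s z≤n) j<∣I∣)
      c , proper , closed , bound = greedy-step G j greedy-j (U ─ I)
        (rs (≤-trans (+-monoˡ-≤ ∣ U ─ I ∣ (≤-trans (s≤s z≤n) j<∣I∣)) ∣I∣+∣U─I∣≤∣U∣))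
      x∈U = I⊆U x∈I
  in addClass G x∈U x∈I iI proper closed
   , addClass-proper G x∈U x∈I iI proper closed
   , addClass-closed G x∈U x∈I iI proper closed
   , λ H H⊆U →
    let t = triangle (suc j) in begin
      suc j * ∣ colors (addClass G x∈U x∈I iI proper closed) H ∣
        ≤⟨ *-monoʳ-≤ (suc j) (∣colors-addClass∣≤ G x∈U x∈I iI proper closed H) ⟩
      suc j * (1 + ∣ colors c (H ─ I) ∣)
        ≡⟨ *-suc (suc j) _ ⟩
      suc j + suc j * ∣ colors c (H ─ I) ∣
        ≤⟨ +-mono-≤ j<∣I∣ (bound (H ─ I) (─-monoˡ-⊆ I H⊆U)) ⟩
      ∣ I ∣ + (∣ U ─ I ∣ + t * χOn G (H ─ I))
        ≡⟨ +-assoc ∣ I ∣ _ _ ⟨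
      ∣ I ∣ + ∣ U ─ I ∣ + t * χOn G (H ─ I)
        ≤⟨ +-mono-≤ ∣I∣+∣U─I∣≤∣U∣ (*-monoʳ-≤ t (χOn-mono G (p─q⊆p H I))) ⟩
      ∣ U ∣ + t * χOn G H ∎
  where open ≤-Reasoning

-- Larger classes come first. For positive `j`, the case `zero` is reached only when nothing is left
-- to color, as any remaining vertex forms an independent set.
greedy : (G : Graph n) (j : ℕ) (U : Subset n) → GreedyColoring G j U
greedy G zero    U = id , idProper G U , id , λ _ _ → z≤n
greedy G (suc j) U = greedy-step G j (greedy G j) U (<-wellFounded _)

-- The three bounds over the integers.

-- The set `S` attains the maximum for `c`, so a bound on φ needs one coloring and an estimate valid
-- for every `S`.
φ≤excess : .{{_ : NonZero n}} (G : Graph n) (c : Fin n → Fin k) → Proper G c →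
           ∃[ S ] φ G ℤ.≤ excess G c S
φ≤excess G c pc with φOf-isGreatest G c
... | (S , _ , eq) , _ = S , subst (φ G ℤ.≤_) eq (proj₂ (φ-isLeast G) _ (_ , c , pc , refl))

a+d≤c+b⇒a-b≤c-d : ∀ a b c d → a + d ≤ c + b → + a ℤ.- + b ℤ.≤ + c ℤ.- + d
a+d≤c+b⇒a-b≤c-d a b c d le = begin
  + a ℤ.- + b           ≡⟨ ℤ.m-n≡m⊖n a b ⟩
  a ℤ.⊖ b               ≡⟨ ℤ.+-cancelˡ-⊖ d a b ⟨
  (d + a) ℤ.⊖ (d + b)   ≡⟨ cong₂ ℤ._⊖_ (+-comm d a) (+-comm d b) ⟩
  (a + d) ℤ.⊖ (b + d)   ≤⟨ ℤ.⊖-monoˡ-≤ (b + d) le ⟩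
  (c + b) ℤ.⊖ (b + d)   ≡⟨ cong (ℤ._⊖ (b + d)) (+-comm c b) ⟩
  (b + c) ℤ.⊖ (b + d)   ≡⟨ ℤ.+-cancelˡ-⊖ b c d ⟩
  c ℤ.⊖ d               ≡⟨ ℤ.m-n≡m⊖n c d ⟨
  + c ℤ.- + d           ∎
  where open ℤ.≤-Reasoning

[a-b]*j≡aj-bj : ∀ a b j → (+ a ℤ.- + b) ℤ.* + j ≡ + (a * j) ℤ.- + (b * j)
[a-b]*j≡aj-bj a b j = begin
  (+ a ℤ.- + b) ℤ.* + j                 ≡⟨ ℤ.*-distribʳ-+ (+ j) (+ a) (ℤ.- + b) ⟩
  + a ℤ.* + j ℤ.+ (ℤ.- + b) ℤ.* + j     ≡⟨ cong (λ z → + a ℤ.* + j ℤ.+ z) (ℤ.neg-distribˡ-* (+ b) (+ j)) ⟨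
  + a ℤ.* + j ℤ.- + b ℤ.* + j           ≡⟨ cong₂ ℤ._-_ (ℤ.pos-* a j) (ℤ.pos-* b j) ⟨
  + (a * j) ℤ.- + (b * j)               ∎
  where open ≡-Reasoning

φ≤n-χ : .{{_ : NonZero n}} (G : Graph n) → φ G ℤ.≤ + n ℤ.- + χ G
-- All vertices get different colors.
φ≤n-χ {n} G with φ≤excess G id (idProper G ⊤)
... | S , φ≤ = ℤ.≤-trans φ≤ (a+d≤c+b⇒a-b≤c-d ∣ colors id S ∣ (χOn G S) n (χ G) (begin
  ∣ colors id S ∣ + χ G              ≤⟨ +-mono-≤ (∣colors∣≤ id S) (χ≤χOn+∣∁∣ G S) ⟩
  ∣ S ∣ + (χOn G S + ∣ ∁ S ∣)        ≡⟨ cong (_+_ ∣ S ∣) (+-comm (χOn G S) _) ⟩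
  ∣ S ∣ + (∣ ∁ S ∣ + χOn G S)        ≡⟨ +-assoc ∣ S ∣ _ _ ⟨
  ∣ S ∣ + ∣ ∁ S ∣ + χOn G S          ≡⟨ cong (λ m → ∣ S ∣ + m + χOn G S) (∣∁p∣≡n∸∣p∣ S) ⟩
  ∣ S ∣ + (n ∸ ∣ S ∣) + χOn G S      ≡⟨ cong (_+ χOn G S) (m+[n∸m]≡n (∣p∣≤n S)) ⟩
  n + χOn G S                        ∎))
  where open ≤-Reasoning

φ*α≤χ*α-χ : .{{_ : NonZero n}} (G : Graph n) → φ G ℤ.* + α G ℤ.≤ + (χ G * α G) ℤ.- + χ G
φ*α≤χ*α-χ G with χOn-isLeast G ⊤
... | (c , pc) , _ with φ≤excess G c pc
... | S , φ≤ = ℤ.≤-trans (ℤ.*-monoʳ-≤-nonNeg (+ α G) φ≤)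
  (ℤ.≤-trans (ℤ.≤-reflexive ([a-b]*j≡aj-bj ∣ colors c S ∣ (χOn G S) (α G)))
    (a+d≤c+b⇒a-b≤c-d (∣ colors c S ∣ * α G) (χOn G S * α G) (χ G * α G) (χ G)
      (m*a+x≤x*a+y (α G) (∣p∣≤n (colors c S))
      (≤-trans (∣colors∣≤ c S)
        (∣S∣≤χOn*a G S λ I _ iI → proj₂ (α-isGreatest G) _ (I , iI , refl))))))
  where
  open ≤-Reasoning

  -- Here m = |c(S)|, x = χ(G) and y = χ(S) α(G). Of the `a` copies of m, one is bounded by y and
  -- the other a - 1 by x.
  m*a+x≤x*a+y : ∀ {m x y} a .{{_ : NonZero a}} → m ≤ x → m ≤ y → m * a + x ≤ x * a + y
  m*a+x≤x*a+y {m} {x} {y} (suc a) m≤x m≤y = begin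
    m * suc a + x      ≡⟨ cong (_+ x) (*-suc m a) ⟩
    m + m * a + x      ≡⟨ +-assoc m _ _ ⟩
    m + (m * a + x)    ≤⟨ +-mono-≤ m≤y (+-monoˡ-≤ x (*-monoˡ-≤ a m≤x)) ⟩
    y + (x * a + x)    ≡⟨ cong (_+_ y) (trans (+-comm _ x) (sym (*-suc x a))) ⟩
    y + x * suc a      ≡⟨ +-comm y _ ⟩
    x * suc a + y      ∎

  instance _ = α-nonZero G

φ*3≤n : .{{_ : NonZero n}} (G : Graph n) → φ G ℤ.* + 3 ℤ.≤ + n
-- Since `triangle 3` is 3, the term in χ(S) cancels exactly after multiplying the excess by 3.
φ*3≤n {n} G with greedy G 3 ⊤
... | c , pc , _ , bound with φ≤excess G c pc
... | S , φ≤ = ℤ.≤-trans (ℤ.*-monoʳ-≤-nonNeg (+ 3) φ≤)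
  (ℤ.≤-trans (ℤ.≤-reflexive ([a-b]*j≡aj-bj ∣ colors c S ∣ (χOn G S) 3))
    (subst (+ (∣ colors c S ∣ * 3) ℤ.- + (χOn G S * 3) ℤ.≤_) (ℤ.+-identityʳ (+ n))
      (a+d≤c+b⇒a-b≤c-d (∣ colors c S ∣ * 3) (χOn G S * 3) n 0 (begin
        ∣ colors c S ∣ * 3 + 0     ≡⟨ +-identityʳ _ ⟩
        ∣ colors c S ∣ * 3         ≡⟨ *-comm ∣ colors c S ∣ 3 ⟩
        3 * ∣ colors c S ∣         ≤⟨ bound S ⊆⊤ ⟩
        ∣ ⊤ {n} ∣ + 3 * χOn G S    ≡⟨ cong₂ _+_ (∣⊤∣≡n n) (*-comm 3 (χOn G S)) ⟩
        n + χOn G S * 3            ∎))))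
  where open ≤-Reasoning

-- Passage to rational numbers.

-- `_/_` reduces to lowest terms, so the comparison is made on unnormalised fractions, where it is
-- cross multiplication.
i*d≤j⇒i/1≤j/d : ∀ i {j} d .{{_ : NonZero d}} → i ℤ.* + d ℤ.≤ j → i / 1 ℚ.≤ j / d
i*d≤j⇒i/1≤j/d i {j} (suc d) le = ℚ.toℚᵘ-cancel-≤ (begin
  ℚ.toℚᵘ (i / 1)       ≃⟨ ℚ.toℚᵘ-fromℚᵘ (mkℚᵘ i 0) ⟩
  mkℚᵘ i 0             ≤⟨ ℚᵘ.*≤* (subst (i ℤ.* + suc d ℤ.≤_) (sym (ℤ.*-identityʳ j)) le) ⟩
  mkℚᵘ j d             ≃⟨ ℚ.toℚᵘ-fromℚᵘ (mkℚᵘ j d) ⟨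
  ℚ.toℚᵘ (j / suc d)   ∎)
  where open ℚᵘ.≤-Reasoning

[x*d-x]/d≡x*[1-1/d] : ∀ x d .{{_ : NonZero d}} →
                      (+ (x * d) ℤ.- + x) / d ≡ (+ x / 1) ℚ.* (1ℚ ℚ.- + 1 / d)
[x*d-x]/d≡x*[1-1/d] x (suc d) = ℚ.toℚᵘ-injective (begin
  ℚ.toℚᵘ ((+ (x * suc d) ℤ.- + x) / suc d)
    ≈⟨ ℚ.toℚᵘ-fromℚᵘ (mkℚᵘ _ d) ⟩
  mkℚᵘ (+ (x * suc d) ℤ.- + x) d
    -- Both denominators are `suc d` up to added zeros, so equal numerators suffice.
    ≈⟨ ℚᵘ.*≡* (cong₂ ℤ._*_ numerator (cong (+_ ∘ suc) (trans (+-identityʳ _) (+-identityʳ d)))) ⟩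
  mkℚᵘ (+ x) 0 ℚᵘ.* (ℚᵘ.1ℚᵘ ℚᵘ.- mkℚᵘ (+ 1) d)
    ≈⟨ ℚᵘ.*-cong (ℚ.toℚᵘ-fromℚᵘ (mkℚᵘ (+ x) 0))
         (ℚᵘ.+-congʳ ℚᵘ.1ℚᵘ (ℚᵘ.-‿cong (ℚ.toℚᵘ-fromℚᵘ (mkℚᵘ (+ 1) d)))) ⟨
  ℚ.toℚᵘ (+ x / 1) ℚᵘ.* (ℚ.toℚᵘ 1ℚ ℚᵘ.- ℚ.toℚᵘ (+ 1 / suc d))
    ≈⟨ ℚᵘ.*-congˡ {ℚ.toℚᵘ (+ x / 1)} (ℚᵘ.+-congʳ ℚᵘ.1ℚᵘ (ℚ.toℚᵘ-homo‿- (+ 1 / suc d))) ⟨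
  ℚ.toℚᵘ (+ x / 1) ℚᵘ.* (ℚ.toℚᵘ 1ℚ ℚᵘ.+ ℚ.toℚᵘ (ℚ.- (+ 1 / suc d)))
    ≈⟨ ℚᵘ.*-congˡ {ℚ.toℚᵘ (+ x / 1)} (ℚ.toℚᵘ-homo-+ 1ℚ (ℚ.- (+ 1 / suc d))) ⟨
  ℚ.toℚᵘ (+ x / 1) ℚᵘ.* ℚ.toℚᵘ (1ℚ ℚ.- + 1 / suc d)
    ≈⟨ ℚ.toℚᵘ-homo-* (+ x / 1) _ ⟨
  ℚ.toℚᵘ ((+ x / 1) ℚ.* (1ℚ ℚ.- + 1 / suc d)) ∎)
  where
  numerator : + (x * suc d) ℤ.- + x ≡ + x ℤ.* (+ 1 ℤ.* + suc d ℤ.+ (ℤ.- + 1) ℤ.* + 1)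
  numerator = begin
    + (x * suc d) ℤ.- + x                ≡⟨ cong₂ ℤ._-_ (ℤ.pos-* x (suc d)) (sym (ℤ.*-identityʳ (+ x))) ⟩
    + x ℤ.* + suc d ℤ.- + x ℤ.* + 1      ≡⟨ cong (λ z → + x ℤ.* + suc d ℤ.+ z) (ℤ.neg-distribʳ-* (+ x) (+ 1)) ⟩
    + x ℤ.* + suc d ℤ.+ + x ℤ.* ℤ.- + 1  ≡⟨ ℤ.*-distribˡ-+ (+ x) (+ suc d) (ℤ.- + 1) ⟨
    + x ℤ.* (+ suc d ℤ.- + 1)            ≡⟨ cong (λ z → + x ℤ.* (z ℤ.- + 1)) (ℤ.*-identityˡ (+ suc d)) ⟨
    + x ℤ.* (+ 1 ℤ.* + suc d ℤ.- + 1)    ∎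
    where open ≡-Reasoning
  open ℚᵘ.≃-Reasoning

theorem3p4 : ∀ {n : ℕ} .{{_ : NonZero n}} (G : Graph n) →
    let instance _ = α-nonZero G in
    (φ G ℤ.≤ + n ℤ.- + χ G)
    × (φ G / 1 ℚ.≤ (+ χ G / 1) ℚ.* (1ℚ ℚ.- + 1 / α G))
    × (φ G / 1 ℚ.≤ + n / 3)
theorem3p4 G =
    φ≤n-χ G
  , subst (φ G / 1 ℚ.≤_) ([x*d-x]/d≡x*[1-1/d] (χ G) (α G)) (i*d≤j⇒i/1≤j/d (φ G) (α G) (φ*α≤χ*α-χ G))
  , i*d≤j⇒i/1≤j/d (φ G) 3 (φ*3≤n G)
  where instance _ = α-nonZero G
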